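{- Let $n\ge 0$ and let $\mathcal M_n^*$ be the dual of the matroid $\mathcal M_n$. For a subset $X\subseteq[n]^\to$ of the ground set and $0\le i<n$, let $X_{i\to}=\{e\in X\mid e \text{ has source } i\}$. Then $X$ is independent in $\mathcal M_n^*$ if and only if $|X_{i\to}|<n-i$ for each $0\le i<n$. Moreover, $X$ is a basis set of $\mathcal M_n^*$ if and only if $|X_{i\to}|=n-i-1$ for each $0\le i<n$.
   Context: $[n]$ denotes the linearly ordered set $\{0<1<\dots<n\}$, with meet $i\wedge j=\min(i,j)$. $[n]^\to$ denotes the set of nontrivial edges of $[n]$, i.e. pairs $(i\to j)$ with $0\le i<j\le n$; the source of the edge $(i\to j)$ is $i$. A transfer system on $[n]$ is a partial order $T$ on the set $[n]$ that is contained in $\le$ (reflexive, transitive, and $i\,T\,j$ implies $i\le j$) and is closed under restriction: if $i\,T\,j$ and $k\in[n]$, then $(i\wedge k)\,T\,(j\wedge k)$. For every $S\subseteq[n]^\to$ there is a smallest transfer system containing $S$, called the transfer system generated by $S$. A set $S\subseteq [n]^\to$ is a minimal generating set if no proper subset of $S$ generates the same transfer system as $S$; $\mathrm{MGS}([n])\subseteq\mathcal P([n]^\to)$ denotes the collection of all minimal generating sets (of all transfer systems on $[n]$). $\mathcal M_n=([n]^\to,\mathrm{MGS}([n]))$ is the matroid with ground set $[n]^\to$ whose independent sets are the elements of $\mathrm{MGS}([n])$ (it is a fact that this pair is a matroid). A basis set of a matroid is a maximal independent set. The dual $M^*$ of a matroid $M$ is the matroid with the same ground set as $M$, whose basis sets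 are the complements of the basis sets of $M$ (so its independent sets are the subsets of such complements). -}

module Defs where

import Algebra.Construct.NaturalChoice.Min as Min
open import Data.Bool.Base using (Bool; not; _∧_; T)
open import Data.Bool.Properties using (T?)
open import Data.Fin.Base using (Fin; toℕ)
import Data.Fin.Base as Fin
import Data.Fin.Properties as Fin
open import Data.List.Base
  using (List; []; _∷_; length; filter; mapMaybe; cartesianProduct; allFin)
open import Data.List.Membership.Propositional using (_∈_)
open import Data.List.Membership.Propositional.Properties
  using (∈-allFin; ∈-cartesianProduct⁺)
open import Data.List.Relation.Unary.All using (All; []; _∷_)
import Data.List.Relation.Unary.All as All
open import Data.List.Relation.Unary.AllPairs using ([]; _∷_)
open import Data.List.Relation.Unary.Any using (here; there)
open import Data.List.Relation.Unary.Unique.Propositional using (Unique)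
import Data.List.Relation.Unary.Unique.Propositional.Properties as Unique
open import Data.Maybe.Base using (Maybe; just; nothing)
open import Data.Nat.Base using (ℕ; suc)
import Data.Nat.Properties as ℕ
open import Data.Product.Base using (∃; _×_; _,_)
open import Level using (Level; 0ℓ)
open import Relation.Binary.Core using (Rel; _⇒_; _⇔_)
open import Relation.Binary.Structures using (IsPartialOrder)
open import Relation.Binary.PropositionalEquality.Core using (_≡_; _≢_; refl)
open import Relation.Binary.PropositionalEquality.Properties using (isEquivalence)
open import Relation.Nullary.Decidable.Core using (yes; no; ⌊_⌋; recompute)
open import Relation.Nullary.Negation.Core using (¬_; contradiction-irr)

private
  variable
    ℓ : Level
    n : ℕ

-- All ground sets below are finite, so Boolean-valued functions represent
-- all subsets of the classical power set.

Subset : Set → Set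
Subset E = E → Bool

infix 4 _∈ₛ_ _⊆_ _⊂_

_∈ₛ_ : {E : Set} → E → Subset E → Set
e ∈ₛ X = T (X e)

_⊆_ : {E : Set} → Subset E → Subset E → Set
X ⊆ Y = ∀ e → e ∈ₛ X → e ∈ₛ Y

_⊂_ : {E : Set} → Subset E → Subset E → Set
X ⊂ Y = X ⊆ Y × ¬ (Y ⊆ X)

∁ : {E : Set} → Subset E → Subset E
∁ X e = not (X e)

-- The data of a matroid. Bases and duals depend only on these data, so the
-- matroid axioms are not included as fields.

record SetSystem : Set₁ where
  field
    Ground      : Set
    Independent : Subset Ground → Set

open SetSystem public

Basis : (M : SetSystem) → Subset (Ground M) → Set
Basis M B = Independent M B
          × (∀ B′ → Independent M B′ → B ⊆ B′ → B′ ⊆ B)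

-- Dual bases are the complements of bases, so dual independent sets are the
-- subsets of such complements.

infix 8 _*

_* : SetSystem → SetSystem
M * = record
  { Ground      = Ground M
  ; Independent = λ X → ∃ λ B → Basis M B × X ⊆ ∁ B
  }

-- [n] = {0 < 1 < … < n} is represented by Fin (suc n).

infixl 7 _⊓_

_⊓_ : Fin (suc n) → Fin (suc n) → Fin (suc n)
_⊓_ {n} = Min._⊓_ (Fin.≤-totalOrder (suc n))

-- The proof field is irrelevant, so an edge is determined by its endpoints.

record Edge (n : ℕ) : Set where
  constructor edge
  field
    source   : Fin (suc n)
    target   : Fin (suc n)
    .source< : source Fin.< target

open Edge public

edge? : Fin (suc n) × Fin (suc n) → Maybe (Edge n)
edge? (i , j) with i Fin.<? j
... | yes i<j = just (edge i j i<j)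
... | no  _   = nothing

edges : (n : ℕ) → List (Edge n)
edges n = mapMaybe edge? (cartesianProduct (allFin (suc n)) (allFin (suc n)))

private
  pairs : Edge n → Fin (suc n) × Fin (suc n)
  pairs e = source e , target e

  edge?-pairs : (e : Edge n) → edge? (pairs e) ≡ just e
  edge?-pairs (edge i j i<j) with i Fin.<? j
  ... | yes _   = refl
  ... | no  i≮j = contradiction-irr i<j i≮j

  ∈-mapMaybe-edge? : ∀ (e : Edge n) {ps} → pairs e ∈ ps → e ∈ mapMaybe edge? ps
  ∈-mapMaybe-edge? e {_ ∷ ps} (here refl) rewrite edge?-pairs e = here refl
  ∈-mapMaybe-edge? e {p ∷ ps} (there q) with edge? p
  ... | just _  = there (∈-mapMaybe-edge? e q)
  ... | nothing = ∈-mapMaybe-edge? e q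

  fresh : ∀ (e : Edge n) {ps} → All (pairs e ≢_) ps → All (e ≢_) (mapMaybe edge? ps)
  fresh e [] = []
  fresh e {(i , j) ∷ ps} (p≢ ∷ ps≢) with i Fin.<? j
  ... | yes _ = (λ { refl → p≢ refl }) ∷ fresh e ps≢
  ... | no  _ = fresh e ps≢

  unique-mapMaybe : ∀ {ps : List (Fin (suc n) × Fin (suc n))} →
                    Unique ps → Unique (mapMaybe edge? ps)
  unique-mapMaybe [] = []
  unique-mapMaybe {ps = (i , j) ∷ ps} (p∉ ∷ u) with i Fin.<? j
  ... | yes i<j = fresh (edge i j i<j) p∉ ∷ unique-mapMaybe u
  ... | no  _   = unique-mapMaybe u

edges-complete : (e : Edge n) → e ∈ edges n
edges-complete e =
  ∈-mapMaybe-edge? e (∈-cartesianProduct⁺ (∈-allFin (source e)) (∈-allFin (target e)))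

edges-unique : (n : ℕ) → Unique (edges n)
edges-unique n = unique-mapMaybe
  (Unique.cartesianProduct⁺ (Unique.allFin⁺ (suc n)) (Unique.allFin⁺ (suc n)))

-- By edges-complete and edges-unique, this is the number of elements of X.

∣_∣ : Subset (Edge n) → ℕ
∣_∣ {n} X = length (filter (λ e → T? (X e)) (edges n))

-- X from i is the set of edges of X with source i.

infix 8 _from_

_from_ : Subset (Edge n) → ℕ → Subset (Edge n)
(X from i) e = X e ∧ ⌊ toℕ (source e) ℕ.≟ i ⌋

record IsTransferSystem {n : ℕ} (R : Rel (Fin (suc n)) ℓ) : Set ℓ where
  field
    isPartialOrder : IsPartialOrder _≡_ R
    contained      : R ⇒ Fin._≤_
    restriction    : ∀ {i j} k → R i j → R (i ⊓ k) (j ⊓ k)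

-- The smallest transfer system containing S; see isTransferSystem, ⊆-Generated
-- and Generated-least.

data Generated {n : ℕ} (S : Subset (Edge n)) : Rel (Fin (suc n)) 0ℓ where
  incl     : ∀ e → e ∈ₛ S → Generated S (source e) (target e)
  reflex   : ∀ {i} → Generated S i i
  transit  : ∀ {i j k} → Generated S i j → Generated S j k → Generated S i k
  restrict : ∀ {i j} k → Generated S i j → Generated S (i ⊓ k) (j ⊓ k)

private
  Generated⇒≤ : {S : Subset (Edge n)} → Generated S ⇒ Fin._≤_
  Generated⇒≤ (incl (edge i j i<j) _) = ℕ.<⇒≤ (recompute (i Fin.<? j) i<j)
  Generated⇒≤ reflex = ℕ.≤-refl
  Generated⇒≤ (transit p q) = ℕ.≤-trans (Generated⇒≤ p) (Generated⇒≤ q)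
  Generated⇒≤ {n} (restrict k p) =
    Min.⊓-monoˡ-≤ (Fin.≤-totalOrder (suc n)) k (Generated⇒≤ p)

isTransferSystem : (S : Subset (Edge n)) → IsTransferSystem (Generated S)
isTransferSystem S = record
  { isPartialOrder = record
    { isPreorder = record
      { isEquivalence = isEquivalence
      ; reflexive     = λ { refl → reflex }
      ; trans         = transit
      }
    ; antisym = λ p q → Fin.≤-antisym (Generated⇒≤ p) (Generated⇒≤ q)
    }
  ; contained   = Generated⇒≤
  ; restriction = restrict
  }

⊆-Generated : (S : Subset (Edge n)) → ∀ e → e ∈ₛ S → Generated S (source e) (target e)
⊆-Generated S = incl

Generated-least : (S : Subset (Edge n)) {R : Rel (Fin (suc n)) ℓ} → IsTransferSystem R →
                  (∀ e → e ∈ₛ S → R (source e) (target e)) → Generated S ⇒ R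
Generated-least S {R} isTS S⊆R = least
  where
  open IsTransferSystem isTS
  module R = IsPartialOrder isPartialOrder

  least : Generated S ⇒ R
  least (incl e e∈S)   = S⊆R e e∈S
  least reflex         = R.refl
  least (transit p q)  = R.trans (least p) (least q)
  least (restrict k p) = restriction k (least p)

MinimalGenerating : Subset (Edge n) → Set
MinimalGenerating S = ∀ S′ → S′ ⊂ S → ¬ (Generated S′ ⇔ Generated S)

𝓜 : ℕ → SetSystem
𝓜 n = record
  { Ground      = Edge n
  ; Independent = MinimalGenerating
  }

{-# OPTIONS --safe #-}

-- An edge restricts to every shorter edge with the same source, whereas every
-- nontrivial relation generated by S starts at the source of an edge of S.
-- Hence S is a minimal generating set iff its edges have distinct sources, and
-- the bases of 𝓜 n are the sets with exactly one edge from each i < n. Since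
-- n ∸ i edges start at i, the complement of X contains such a set iff
-- ∣ X from i ∣ < n ∸ i for all i < n, and is one iff ∣ X from i ∣ ≡ n ∸ i ∸ 1.

module Submission where

open import Defs
open import Data.Bool.Base using (true; false; not; _∧_; _∨_)
open import Data.Bool.Properties using (T?; T-∧; T-∨)
open import Data.Fin.Base using (Fin; toℕ; fromℕ; fromℕ<)
import Data.Fin.Base as Fin
import Data.Fin.Properties as Fin
import Algebra.Construct.NaturalChoice.Min as Min
open import Data.List.Base using (List; []; _∷_; length; filter; head; tabulate)
open import Data.List.Membership.Propositional using (_∈_)
open import Data.List.Membership.Propositional.Properties
  using (∈-filter⁺; ∈-filter⁻; ∈-tabulate⁺; ∈-tabulate⁻; ∈-length)
open import Data.List.Membership.Propositional.Properties.WithK using (unique∧set⇒bag)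
open import Data.List.Properties using (length-tabulate)
open import Data.List.Relation.Binary.BagAndSetEquality using (∼bag⇒↭)
open import Data.List.Relation.Binary.Permutation.Propositional.Properties using (↭-length)
open import Data.List.Relation.Unary.All using ([]; _∷_)
open import Data.List.Relation.Unary.AllPairs using ([]; _∷_)
open import Data.List.Relation.Unary.Any using (here; there)
open import Data.List.Relation.Unary.Unique.Propositional using (Unique)
import Data.List.Relation.Unary.Unique.Propositional.Properties as Unique
open import Data.Maybe.Base using (just)
import Data.Maybe.Properties as Maybe
open import Data.Nat.Base using (ℕ; suc; _+_; _≤_; _<_; _∸_; z≤n; s≤s)
import Data.Nat.Properties as ℕ
open import Data.Product.Base using (∃; _×_; _,_; proj₁; proj₂)
open import Data.Sum.Base using (_⊎_; inj₁; inj₂; [_,_]′)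
open import Function.Base using (_∘_)
open import Function.Bundles using (_⇔_; mk⇔; Equivalence)
open import Relation.Binary.Definitions using (DecidableEquality; tri<; tri≈; tri>)
open import Relation.Binary.PropositionalEquality
  using (_≡_; refl; sym; trans; cong; subst; subst₂)
open import Relation.Nullary.Decidable.Core
  using (yes; no; ⌊_⌋; recompute; toWitness; fromWitness; decidable-stable)
open import Relation.Nullary.Negation.Core using (¬_; contradiction)

private
  variable
    n i : ℕ
    A : Set

-- Complements and edges

∈-∁⁻ : ∀ {e : A} (X : Subset A) → e ∈ₛ ∁ X → ¬ (e ∈ₛ X)
∈-∁⁻ {e = e} X e∈∁X e∈X with X e
... | true = e∈∁X

∈-∁⁺ : ∀ {e : A} (X : Subset A) → ¬ (e ∈ₛ X) → e ∈ₛ ∁ X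
∈-∁⁺ {e = e} X e∉X with X e
... | true  = e∉X _
... | false = _

edge-≡ : {e f : Edge n} → source e ≡ source f → target e ≡ target f → e ≡ f
edge-≡ refl refl = refl

_≟_ : DecidableEquality (Edge n)
e ≟ f with source e Fin.≟ source f | target e Fin.≟ target f
... | yes p | yes q = yes (edge-≡ p q)
... | no ¬p | _     = no λ { refl → ¬p refl }
... | _     | no ¬q = no λ { refl → ¬q refl }

-- The proof stored in an edge is irrelevant; decidability of the order recomputes a usable one.
source<target : (e : Edge n) → source e Fin.< target e
source<target (edge i j i<j) = recompute (i Fin.<? j) i<j

-- No edge starts at the top element n, so conditions imposed for all i < n reach every edge.
source<n : (e : Edge n) → toℕ (source e) < n
source<n e = ℕ.<-≤-trans (source<target e) (Fin.toℕ≤pred[n] (target e))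

-- Minimal generating sets

module _ {n : ℕ} where
  open Min (Fin.≤-totalOrder (suc n)) public using (x≤y⇒x⊓y≈x; x≤y⇒y⊓x≈x)

-- Induction on the derivation: a composite inherits the source of its first nontrivial factor, and
-- a restriction either keeps the source or becomes trivial.
Generated-source : {S : Subset (Edge n)} {i j : Fin (suc n)} → Generated S i j →
                   i ≡ j ⊎ ∃ λ e → e ∈ₛ S × source e ≡ i
Generated-source (incl e e∈S) = inj₂ (e , e∈S , refl)
Generated-source reflex = inj₁ refl
Generated-source (transit p q) with Generated-source p
... | inj₁ refl = Generated-source q
... | inj₂ r    = inj₂ r
Generated-source {S = S} (restrict {i} k p) with Generated-source p
... | inj₁ refl = inj₁ refl
... | inj₂ (e , e∈S , refl) =
  -- If i ≤ k, the meet leaves i alone; if k ≤ i, then k also lies below the upper end, and both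
  -- ends collapse to k.
  [ (λ i≤k → inj₂ (e , e∈S , sym (x≤y⇒x⊓y≈x i≤k)))
  , (λ k≤i → inj₁ (trans (x≤y⇒y⊓x≈x k≤i)
                         (sym (x≤y⇒y⊓x≈x (Fin.≤-trans k≤i (contained p))))))
  ]′ (Fin.≤-total i k)
  where open IsTransferSystem (isTransferSystem S)

SourceInjective : Subset (Edge n) → Set
SourceInjective S = ∀ {e f} → e ∈ₛ S → f ∈ₛ S → source e ≡ source f → e ≡ f

remove : Edge n → Subset (Edge n) → Subset (Edge n)
remove e S f = S f ∧ not ⌊ f ≟ e ⌋

∈-remove⁺ : ∀ {e f} (S : Subset (Edge n)) → f ∈ₛ S → ¬ (f ≡ e) → f ∈ₛ remove e S
∈-remove⁺ {e = e} {f} S f∈S f≢e =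
  Equivalence.from T-∧ (f∈S , ∈-∁⁺ (λ f → ⌊ f ≟ e ⌋) (f≢e ∘ toWitness))

remove-⊂ : ∀ {e} (S : Subset (Edge n)) → e ∈ₛ S → remove e S ⊂ S
remove-⊂ {e = e} S e∈S =
  (λ f → proj₁ ∘ Equivalence.to T-∧) ,
  λ S⊆ → ∈-∁⁻ {e = e} (λ f → ⌊ f ≟ e ⌋) (proj₂ (Equivalence.to T-∧ (S⊆ e e∈S)))
                (fromWitness refl)

Generated-mono : {S R : Subset (Edge n)} →
                 (∀ e → e ∈ₛ S → Generated R (source e) (target e)) →
                 ∀ {i j} → Generated S i j → Generated R i j
Generated-mono {S = S} {R} S⊆ = Generated-least S (isTransferSystem R) S⊆

-- The shorter edge `e` is a restriction of the longer edge `f`, so `remove e S` would generate the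
-- same transfer system.
minimal⇒no-longer-edge : {S : Subset (Edge n)} {e f : Edge n} → MinimalGenerating S →
  e ∈ₛ S → f ∈ₛ S → source e ≡ source f → ¬ (target e Fin.< target f)
minimal⇒no-longer-edge {S = S} {e} {f} min e∈S f∈S refl e<f =
  min (remove e S) (remove-⊂ S e∈S)
    ( Generated-mono (λ g → incl g ∘ proj₁ (remove-⊂ S e∈S) g)
    , Generated-mono generates)
  where
  -- Meeting `f` with `target e` keeps the common source and cuts the target down to `target e`; `f`
  -- survives the removal because its target differs.
  restricted : Generated (remove e S) (source e) (target e)
  restricted = subst₂ (Generated (remove e S))
    (x≤y⇒x⊓y≈x (ℕ.<⇒≤ (source<target e))) (x≤y⇒y⊓x≈x (ℕ.<⇒≤ e<f))
    (restrict (target e) (incl f (∈-remove⁺ S f∈S λ { refl → ℕ.<-irrefl refl e<f })))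

  generates : ∀ g → g ∈ₛ S → Generated (remove e S) (source g) (target g)
  generates g g∈S with g ≟ e
  ... | yes refl = restricted
  ... | no  g≢e  = incl g (∈-remove⁺ S g∈S g≢e)

minimal⇒sourceInjective : {S : Subset (Edge n)} → MinimalGenerating S → SourceInjective S
minimal⇒sourceInjective min {e} {f} e∈S f∈S eq with Fin.<-cmp (target e) (target f)
... | tri< e<f _ _ = contradiction e<f (minimal⇒no-longer-edge min e∈S f∈S eq)
... | tri≈ _ e≡f _ = edge-≡ eq e≡f
... | tri> _ _ f<e = contradiction f<e (minimal⇒no-longer-edge min f∈S e∈S (sym eq))

-- If `S′` generates an edge `e` of `S`, it contains an edge with the source of `e`. As `S′` lies in
-- `S`, injectivity makes that edge `e` itself, so `S′` omits nothing.
sourceInjective⇒minimal : {S : Subset (Edge n)} → SourceInjective S → MinimalGenerating S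
sourceInjective⇒minimal {S = S} inj S′ (S′⊆S , S⊈S′) (_ , S⇒S′) = S⊈S′ S⊆S′
  where
  S⊆S′ : S ⊆ S′
  S⊆S′ e e∈S with Generated-source (S⇒S′ (incl e e∈S))
  ... | inj₁ eq = contradiction (source<target e) (Fin.<-irrefl eq)
  ... | inj₂ (f , f∈S′ , eq) = subst (_∈ₛ S′) (inj (S′⊆S f f∈S′) e∈S eq) f∈S′

-- Bases

SourceSurjective : Subset (Edge n) → Set
SourceSurjective {n} S = ∀ i → i < n → ∃ λ e → e ∈ₛ S × toℕ (source e) ≡ i

elements : Subset (Edge n) → List (Edge n)
elements {n} X = filter (λ e → T? (X e)) (edges n)

∈-elements⁺ : ∀ {e} (X : Subset (Edge n)) → e ∈ₛ X → e ∈ elements X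
∈-elements⁺ X e∈X = ∈-filter⁺ (T? ∘ X) (edges-complete _) e∈X

∈-elements⁻ : ∀ {e} (X : Subset (Edge n)) → e ∈ elements X → e ∈ₛ X
∈-elements⁻ {n} X e∈ = proj₂ (∈-filter⁻ (T? ∘ X) {xs = edges n} e∈)

elements-unique : (X : Subset (Edge n)) → Unique (elements X)
elements-unique X = Unique.filter⁺ (T? ∘ X) (edges-unique _)

∈-from⁺ : ∀ {e} (X : Subset (Edge n)) → e ∈ₛ X → toℕ (source e) ≡ i → e ∈ₛ X from i
∈-from⁺ X e∈X eq = Equivalence.from T-∧ (e∈X , fromWitness eq)

∈-from⁻ : ∀ {e} (X : Subset (Edge n)) → e ∈ₛ X from i → e ∈ₛ X × toℕ (source e) ≡ i
∈-from⁻ X e∈ = let e∈X , eq = Equivalence.to T-∧ e∈ in e∈X , toWitness eq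

head-∈ : ∀ {x} (xs : List A) → head xs ≡ just x → x ∈ xs
head-∈ (x ∷ xs) refl = here refl

nonempty⇒head : (xs : List A) → 0 < length xs → ∃ λ x → head xs ≡ just x
nonempty⇒head (x ∷ xs) _ = x , refl

-- Edges with equal source are compared with the head of the same list, so at most one of them is
-- chosen.
choose : Subset (Edge n) → Subset (Edge n)
choose X e = ⌊ Maybe.≡-dec _≟_ (head (elements (X from toℕ (source e)))) (just e) ⌋

choose-⊆ : (X : Subset (Edge n)) → choose X ⊆ X
choose-⊆ X e e∈ = proj₁ (∈-from⁻ X (∈-elements⁻ _ (head-∈ _ (toWitness e∈))))

choose-sourceInjective : (X : Subset (Edge n)) → SourceInjective (choose X)
choose-sourceInjective X {edge i _ _} {edge .i _ _} e∈ f∈ refl =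
  Maybe.just-injective (trans (sym (toWitness e∈)) (toWitness f∈))

choose-sourceSurjective : (X : Subset (Edge n)) → (∀ i → i < n → 0 < ∣ X from i ∣) →
                          SourceSurjective (choose X)
choose-sourceSurjective X pos i i<n with nonempty⇒head (elements (X from i)) (pos i i<n)
... | e , eq with ∈-from⁻ X (∈-elements⁻ _ (head-∈ _ eq))
-- Matching on `refl` turns i into `toℕ (source e)`, so `eq` becomes exactly the test made by
-- `choose`.
... | _ , refl = e , fromWitness eq , refl

nonempty⇒∃ : (X : Subset (Edge n)) → 0 < ∣ X from i ∣ →
             ∃ λ e → e ∈ₛ X × toℕ (source e) ≡ i
nonempty⇒∃ X pos with nonempty⇒head (elements (X from _)) pos
... | e , eq = e , ∈-from⁻ X (∈-elements⁻ _ (head-∈ _ eq))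

∃⇒nonempty : (X : Subset (Edge n)) → (∃ λ e → e ∈ₛ X × toℕ (source e) ≡ i) →
             0 < ∣ X from i ∣
∃⇒nonempty X (e , e∈X , eq) = ∈-length (∈-elements⁺ (X from _) (∈-from⁺ X e∈X eq))

insert : Edge n → Subset (Edge n) → Subset (Edge n)
insert e S f = S f ∨ ⌊ f ≟ e ⌋

∈-insert⁻ : ∀ {e f} (S : Subset (Edge n)) → f ∈ₛ insert e S → f ∈ₛ S ⊎ f ≡ e
∈-insert⁻ S f∈ with Equivalence.to T-∨ f∈
... | inj₁ f∈S = inj₁ f∈S
... | inj₂ f≡e = inj₂ (toWitness f≡e)

insert-sourceInjective : ∀ {e} {S : Subset (Edge n)} → SourceInjective S →
  (∀ f → f ∈ₛ S → ¬ (source f ≡ source e)) → SourceInjective (insert e S)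
insert-sourceInjective {S = S} inj new f∈ g∈ eq with ∈-insert⁻ S f∈ | ∈-insert⁻ S g∈
... | inj₁ f∈S  | inj₁ g∈S  = inj f∈S g∈S eq
... | inj₁ f∈S  | inj₂ refl = contradiction eq (new _ f∈S)
... | inj₂ refl | inj₁ g∈S  = contradiction (sym eq) (new _ g∈S)
... | inj₂ refl | inj₂ refl = refl

-- If no edge of `B` started at i, inserting the edge from i to n would keep the sources distinct,
-- contrary to maximality.
basis⇒sourceSurjective : {B : Subset (Edge n)} → Basis (𝓜 n) B → SourceSurjective B
basis⇒sourceSurjective {n} {B} (min , max) i i<n =
  -- Positivity of the count is decidable, so the argument by contradiction still yields an actual
  -- edge.
  nonempty⇒∃ B (decidable-stable (0 ℕ.<? _) λ empty →
    let
      new : ∀ f → f ∈ₛ B → ¬ (toℕ (source f) ≡ i)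
      new f f∈B eq = empty (∃⇒nonempty B (f , f∈B , eq))
    in
    new e
      (max (insert e B)
        (sourceInjective⇒minimal
          (insert-sourceInjective (minimal⇒sourceInjective min)
            λ f f∈B eq → new f f∈B (trans (cong toℕ eq) source-e)))
        (λ f f∈B → Equivalence.from T-∨ (inj₁ f∈B))
        e (Equivalence.from (T-∨ {x = B e}) (inj₂ (fromWitness refl))))
      source-e)
  where
  i<1+n : i < suc n
  i<1+n = ℕ.m<n⇒m<1+n i<n

  source-e : toℕ (fromℕ< i<1+n) ≡ i
  source-e = Fin.toℕ-fromℕ< i<1+n

  e : Edge n
  e = edge (fromℕ< i<1+n) (fromℕ n)
    (subst₂ _<_ (sym source-e) (sym (Fin.toℕ-fromℕ n)) i<n)

-- An edge `e` of a larger independent set `B′` shares its source with some `f` in `B`. Both lie in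
-- `B′`, whose sources are distinct, so `e` is `f`.
transversal⇒basis : {B : Subset (Edge n)} →
                    SourceInjective B → SourceSurjective B → Basis (𝓜 n) B
transversal⇒basis {B = B} inj surj = sourceInjective⇒minimal inj , max
  where
  max : ∀ B′ → MinimalGenerating B′ → B ⊆ B′ → B′ ⊆ B
  max B′ min B⊆B′ e e∈B′ with surj _ (source<n e)
  ... | f , f∈B , eq =
    subst (_∈ₛ B)
      (minimal⇒sourceInjective min (B⊆B′ f f∈B) e∈B′ (Fin.toℕ-injective eq)) f∈B

-- Counting edges by source

filter-complement : (X Y : Subset A) (xs : List A) →
  length (filter (λ x → T? (X x ∧ Y x)) xs) + length (filter (λ x → T? (∁ X x ∧ Y x)) xs)
  ≡ length (filter (T? ∘ Y) xs)
filter-complement X Y [] = refl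
filter-complement X Y (x ∷ xs) with X x | Y x
... | true  | true  = cong suc (filter-complement X Y xs)
... | true  | false = filter-complement X Y xs
... | false | true  = trans (ℕ.+-suc _ _) (cong suc (filter-complement X Y xs))
... | false | false = filter-complement X Y xs

length≤1 : {xs : List A} → Unique xs → (∀ {x y} → x ∈ xs → y ∈ xs → x ≡ y) → length xs ≤ 1
length≤1 {xs = []}         _              _   = z≤n
length≤1 {xs = x ∷ []}     _              _   = s≤s z≤n
length≤1 {xs = x ∷ y ∷ xs} ((x≢y ∷ _) ∷ _) all =
  contradiction (all (here refl) (there (here refl))) x≢y

length≤1⇒≡ : {xs : List A} {x y : A} → length xs ≤ 1 → x ∈ xs → y ∈ xs → x ≡ y
length≤1⇒≡ {xs = _ ∷ []}    _        (here refl) (here refl) = refl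
length≤1⇒≡ {xs = _ ∷ _ ∷ _} (s≤s ()) _           _

full : Subset (Edge n)
full _ = true

module _ {n i : ℕ} (i≤n : i ≤ n) where

  private
    source′ : Fin (suc n)
    source′ = fromℕ< (s≤s i≤n)

    target< : (k : Fin (n ∸ i)) → suc i + toℕ k < suc n
    target< k = s≤s
      (ℕ.<-≤-trans (ℕ.+-monoʳ-< i (Fin.toℕ<n k)) (ℕ.≤-reflexive (ℕ.m+[n∸m]≡n i≤n)))

    target′ : Fin (n ∸ i) → Fin (suc n)
    target′ k = fromℕ< (target< k)

    edgeFrom : Fin (n ∸ i) → Edge n
    edgeFrom k = edge source′ (target′ k)
      (subst₂ _<_ (sym (Fin.toℕ-fromℕ< (s≤s i≤n))) (sym (Fin.toℕ-fromℕ< (target< k)))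
        (ℕ.m≤m+n (suc i) (toℕ k)))

    edgeFrom-injective : ∀ {k l} → edgeFrom k ≡ edgeFrom l → k ≡ l
    edgeFrom-injective {k} {l} eq = Fin.toℕ-injective (ℕ.+-cancelˡ-≡ (suc i) _ _
      (Fin.fromℕ<-injective _ _ (target< k) (target< l) (cong target eq)))

    edgeFrom-surjective : ∀ e → toℕ (source e) ≡ i → ∃ λ k → e ≡ edgeFrom k
    edgeFrom-surjective e eq = fromℕ< k< , edge-≡
      (Fin.toℕ-injective (trans eq (sym (Fin.toℕ-fromℕ< (s≤s i≤n)))))
      (Fin.toℕ-injective (sym (trans (Fin.toℕ-fromℕ< (target< _))
        (trans (cong (suc i +_) (Fin.toℕ-fromℕ< k<)) (ℕ.m+[n∸m]≡n i<target)))))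
      where
      i<target : i < toℕ (target e)
      i<target = subst (_< _) eq (source<target e)

      -- Subtract `suc i` from both sides of `toℕ (target e) < suc n`; the right side computes to
      -- `n ∸ i`.
      k< : toℕ (target e) ∸ suc i < n ∸ i
      k< = ℕ.∸-monoˡ-< (Fin.toℕ<n (target e)) i<target

  -- The filtered list and the tabulation of `edgeFrom` are duplicate-free with the same members,
  -- hence permutations of each other.
  ∣full-from∣ : ∣ full {n} from i ∣ ≡ n ∸ i
  ∣full-from∣ = trans
    (↭-length (∼bag⇒↭ (unique∧set⇒bag
      (elements-unique (full from i)) (Unique.tabulate⁺ edgeFrom-injective)
      (mk⇔ forth back))))
    (length-tabulate edgeFrom)
    where
    forth : ∀ {e} → e ∈ elements (full from i) → e ∈ tabulate edgeFrom
    forth {e} e∈ with edgeFrom-surjective e (proj₂ (∈-from⁻ {e = e} full (∈-elements⁻ _ e∈)))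
    ... | k , refl = ∈-tabulate⁺ k

    back : ∀ {e} → e ∈ tabulate edgeFrom → e ∈ elements (full from i)
    back e∈ with ∈-tabulate⁻ e∈
    ... | k , refl =
      ∈-elements⁺ (full from i) (∈-from⁺ {e = edgeFrom k} full _ (Fin.toℕ-fromℕ< (s≤s i≤n)))

  ∣from∣+∣∁-from∣ : (X : Subset (Edge n)) → ∣ X from i ∣ + ∣ ∁ X from i ∣ ≡ n ∸ i
  -- `full from i` reduces to the bare source test, which is the second predicate passed to
  -- `filter-complement`.
  ∣from∣+∣∁-from∣ X = trans (filter-complement X _ (edges n)) ∣full-from∣

∣from∣≤1 : {X : Subset (Edge n)} → SourceInjective X → ∣ X from i ∣ ≤ 1
∣from∣≤1 {X = X} inj = length≤1 (elements-unique (X from _)) λ e∈ f∈ →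
  let e∈X , p = ∈-from⁻ X (∈-elements⁻ _ e∈)
      f∈X , q = ∈-from⁻ X (∈-elements⁻ _ f∈)
  in inj e∈X f∈X (Fin.toℕ-injective (trans p (sym q)))

∣from∣≤1⇒sourceInjective : (X : Subset (Edge n)) → (∀ i → i < n → ∣ X from i ∣ ≤ 1) →
                           SourceInjective X
∣from∣≤1⇒sourceInjective X ≤1 {e} {f} e∈X f∈X eq = length≤1⇒≡ (≤1 _ (source<n f))
  (∈-elements⁺ (X from _) (∈-from⁺ X e∈X (cong toℕ eq)))
  (∈-elements⁺ (X from _) (∈-from⁺ X f∈X refl))

<-total⇔0<part : ∀ {a b c} → a + b ≡ c → a < c ⇔ 0 < b
<-total⇔0<part {a} {b} refl = mk⇔
  (λ a<a+b → ℕ.+-cancelˡ-< a 0 b (subst (_< a + b) (sym (ℕ.+-identityʳ a)) a<a+b))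
  (ℕ.m<m+n a)

-- Positivity of c excludes truncation: at c = 0 the left equation would hold with b = 0.
≡-total∸1⇔part≡1 : ∀ {a b c} → a + b ≡ c → 0 < c → a ≡ c ∸ 1 ⇔ b ≡ 1
≡-total∸1⇔part≡1 {a} {b} {suc c} eq _ = mk⇔
  (λ { refl → ℕ.+-cancelˡ-≡ a _ _ (trans eq (ℕ.+-comm 1 a)) })
  (λ { refl → ℕ.suc-injective (trans (ℕ.+-comm 1 a) eq) })

-- The dual matroid

-- A basis witnesses independence of `X` when it lies inside `∁ X`. Such a basis supplies an edge
-- outside `X` from each i < n; conversely, `choose` picks one from `∁ X`.
dualIndependent⇔ : (X : Subset (Edge n)) →
  Independent (𝓜 n *) X ⇔ (∀ i → i < n → 0 < ∣ ∁ X from i ∣)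
dualIndependent⇔ X = mk⇔ forth back
  where
  forth : Independent (𝓜 _ *) X → ∀ i → i < _ → 0 < ∣ ∁ X from i ∣
  forth (B , basis , X⊆∁B) i i<n with basis⇒sourceSurjective basis i i<n
  ... | e , e∈B , eq =
    ∃⇒nonempty (∁ X) (e , ∈-∁⁺ X (λ e∈X → ∈-∁⁻ B (X⊆∁B e e∈X) e∈B) , eq)

  back : (∀ i → i < _ → 0 < ∣ ∁ X from i ∣) → Independent (𝓜 _ *) X
  back pos = choose (∁ X)
    , transversal⇒basis (choose-sourceInjective (∁ X)) (choose-sourceSurjective (∁ X) pos)
    , λ e e∈X → ∈-∁⁺ (choose (∁ X)) λ e∈ → ∈-∁⁻ X (choose-⊆ (∁ X) e e∈) e∈X

-- Independence gives at least one edge outside `X` per source. Maximality amounts to there being at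
-- most one, since a second could be added to `X`.
dualBasis⇔ : (X : Subset (Edge n)) →
  Basis (𝓜 n *) X ⇔ (∀ i → i < n → ∣ ∁ X from i ∣ ≡ 1)
dualBasis⇔ X = mk⇔ forth back
  where
  forth : Basis (𝓜 _ *) X → ∀ i → i < _ → ∣ ∁ X from i ∣ ≡ 1
  forth (indep@(B , basis , X⊆∁B) , max) i i<n = ℕ.≤-antisym
    (∣from∣≤1 λ e∈ f∈ → minimal⇒sourceInjective (proj₁ basis) (∁X⊆B _ e∈) (∁X⊆B _ f∈))
    (Equivalence.to (dualIndependent⇔ X) indep i i<n)
    where
    -- Maximality is applied to `∁ B`, a dual independent set containing `X`; hence `∁ X` inherits
    -- distinct sources from `B`.
    ∁X⊆B : ∁ X ⊆ B
    ∁X⊆B e e∈∁X = decidable-stable (T? (B e)) λ e∉B →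
      ∈-∁⁻ X e∈∁X (max (∁ B) (B , basis , λ _ e∈ → e∈) X⊆∁B e (∈-∁⁺ B e∉B))

  back : (∀ i → i < _ → ∣ ∁ X from i ∣ ≡ 1) → Basis (𝓜 _ *) X
  back ≡1 = Equivalence.from (dualIndependent⇔ X) (λ i i<n → ℕ.≤-reflexive (sym (≡1 i i<n)))
          , max
    where
    max : ∀ Y → Independent (𝓜 _ *) Y → X ⊆ Y → Y ⊆ X
    -- Some `f` outside `Y`, hence outside `X`, has the source of `e`. Were `e` outside `X` too,
    -- uniqueness would give `f ≡ e`, although `e` lies in `Y`.
    max Y indep X⊆Y e e∈Y = decidable-stable (T? (X e)) λ e∉X →
      let f , f∈∁Y , eq =
            nonempty⇒∃ (∁ Y) (Equivalence.to (dualIndependent⇔ Y) indep _ (source<n e))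
          f≡e = ∣from∣≤1⇒sourceInjective (∁ X) (λ i i<n → ℕ.≤-reflexive (≡1 i i<n))
                  (∈-∁⁺ X λ f∈X → ∈-∁⁻ Y f∈∁Y (X⊆Y f f∈X)) (∈-∁⁺ X e∉X)
                  (Fin.toℕ-injective eq)
      in ∈-∁⁻ Y (subst (_∈ₛ ∁ Y) f≡e f∈∁Y) e∈Y

theorem3p5 : (n : ℕ) (X : Subset (Edge n)) →
    (Independent (𝓜 n *) X ⇔ (∀ i → i < n → ∣ X from i ∣ < n ∸ i))
    × (Basis (𝓜 n *) X ⇔ (∀ i → i < n → ∣ X from i ∣ ≡ n ∸ i ∸ 1))
theorem3p5 n X =
  mk⇔ (λ indep i i<n → to⁻¹ (less i<n) (to (dualIndependent⇔ X) indep i i<n))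
      (λ h → to⁻¹ (dualIndependent⇔ X) λ i i<n → to (less i<n) (h i i<n))
  , mk⇔ (λ basis i i<n → to⁻¹ (equal i<n) (to (dualBasis⇔ X) basis i i<n))
        (λ h → to⁻¹ (dualBasis⇔ X) λ i i<n → to (equal i<n) (h i i<n))
  where
  open Equivalence using (to) renaming (from to to⁻¹)

  -- Both conversions rest on the n - i edges from i being split between `X` and `∁ X`.
  less : ∀ {i} → i < n → ∣ X from i ∣ < n ∸ i ⇔ 0 < ∣ ∁ X from i ∣
  less i<n = <-total⇔0<part (∣from∣+∣∁-from∣ (ℕ.<⇒≤ i<n) X)

  equal : ∀ {i} → i < n → ∣ X from i ∣ ≡ n ∸ i ∸ 1 ⇔ ∣ ∁ X from i ∣ ≡ 1
  equal i<n = ≡-total∸1⇔part≡1 (∣from∣+∣∁-from∣ (ℕ.<⇒≤ i<n) X) (ℕ.m<n⇒0<n∸m i<n)
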